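{- Suppose a 4-regular multigraph $F$ has three pairwise compatible Euler systems $C$, $C'$ and $C''$ (that is, no two of $C,C',C''$ involve the same transition at any vertex). Then $$\mathcal{I}_{C}(C')\cdot\mathcal{I}_{C''}(C)\cdot\mathcal{I}_{C'}(C'')$$ is the identity matrix (over $GF(2)$).
   Context: Multigraphs are finite; in a 4-regular multigraph every vertex has degree 4, and loops and parallel edges are allowed (a loop contributes 2 to the degree of its vertex). Each edge consists of two half-edges, so exactly four half-edges are incident at each vertex. A transition at a vertex $v$ is one of the three ways to sort the four half-edges at $v$ into two disjoint pairs. A circuit is a closed walk with no repeated edge; circuits are considered without preferred starting point or orientation. Choosing one transition at each vertex of $F$ yields a partition of the edge set $E(F)$ into edge-disjoint circuits (consecutive half-edges of a circuit passing through a vertex are those paired by the chosen transition); such a partition, together with its transitions, is a circuit partition $P$ of $F$, and $P$ is said to involve the chosen transition at each vertex. An Euler system is a circuit partition containing exactly one circuit (an Euler circuit, containing every edge of the component) for each connected component of $F$. Interlacement: given an Euler system $C$, two vertices $v\neq w$ are interlaced with respect to $C$ if they appear in the order $v\ldots w\ldots v\ldots w$ on one of the circuits of $C$. The interlacement matrix $\mathcal{I}(C)$ is the $V(F)\times V(F)$ zero-diagonal symmetric matrix over $GF(2)$ whose $vw$ entry ($v\neq w$) is $1$ if and only if $v$ and $w$ are interlaced with respect to $C$. Transition labels with respect to $C$: at a vertex $v$, orient the circuit of $C$ incident at $v$ (either way). The transition followed by $C$ at $v$ is labeled $\phi$; the other transition in which in-directed half-edges are paired with out-directed half-edges is labeled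 $\chi$; the transition in which the two in-directed half-edges are paired with each other and the two out-directed half-edges are paired with each other is labeled $\psi$. Relative interlacement matrix: for a circuit partition $P$ (for instance an Euler system) and an Euler system $C$ of $F$, $\mathcal{I}_P(C)$ is obtained from $\mathcal{I}(C)$ as follows, all labels being with respect to $C$. If $P$ involves the $\phi$ transition at $v$, change every nonzero entry of the row and column corresponding to $v$ to $0$, and change the diagonal entry of $v$ from $0$ to $1$. If $P$ involves the $\psi$ transition at $v$, change the diagonal entry of $v$ from $0$ to $1$. (No change on account of vertices where $P$ involves the $\chi$ transition.) -}

module Defs where

open import Algebra.Bundles using (CommutativeRing)
import Algebra.Definitions.RawMonoid as RawMonoidDefs
open import Data.Bool.Base using (Bool; _∨_; if_then_else_)
open import Data.Bool.Properties using (xor-∧-commutativeRing)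
open import Data.Fin.Base as Fin using (Fin; toℕ; fromℕ<)
open import Data.Fin.Properties
  using (_≟_; _<?_; any?; all?; injective⇒≤; toℕ-fromℕ<)
open import Data.List.Base using (length; filter; allFin)
open import Data.Nat.Base using (ℕ; suc; _≤_; _<_; s≤s)
open import Data.Nat.GeneralisedArithmetic using (iterate)
import Data.Nat.Properties as ℕ
open import Data.Product using (∃; ∃-syntax; ∃!; _×_; _,_)
open import Data.Sum.Base using (_⊎_; inj₁)
open import Function.Bundles using (_⇔_)
open import Relation.Binary.Construct.Closure.ReflexiveTransitive using (Star)
open import Relation.Binary.PropositionalEquality
  using (_≡_; _≢_; sym; subst)
open import Relation.Nullary.Decidable
  using (Dec; does; yes; no; map′; ¬?; _×-dec_; _⊎-dec_; _→-dec_)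
open import Relation.Nullary.Negation using (¬_)

------------------------------------------------------------------------
-- Matrices over GF(2), the field (Bool, xor, ∧)

module GF2 = CommutativeRing xor-∧-commutativeRing

open RawMonoidDefs GF2.+-rawMonoid public using (sum)

Matrix : ℕ → Set
Matrix n = Fin n → Fin n → GF2.Carrier

infixl 7 _·_

_·_ : ∀ {n} → Matrix n → Matrix n → Matrix n
(A · B) i j = sum λ k → A i k GF2.* B k j

𝟙 : ∀ {n} → Matrix n
𝟙 i j = if does (i ≟ j) then GF2.1# else GF2.0#

------------------------------------------------------------------------
-- Multigraphs

-- An edge is an orbit {h , opp h} of the fixed-point-free involution
-- opp, so loops and parallel edges are allowed.
record Multigraph : Set where
  field
    #vertices      : ℕ
    #halfEdges     : ℕ
  Vertex : Set
  Vertex = Fin #vertices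
  HalfEdge : Set
  HalfEdge = Fin #halfEdges
  field
    inc            : HalfEdge → Vertex
    opp            : HalfEdge → HalfEdge
    opp-involutive : ∀ h → opp (opp h) ≡ h
    opp-fixfree    : ∀ h → opp h ≢ h

  degree : Vertex → ℕ
  degree v = length (filter (λ h → inc h ≟ v) (allFin #halfEdges))

  SameEdge : HalfEdge → HalfEdge → Set
  SameEdge g h = g ≡ h ⊎ g ≡ opp h

  Adjacent : Vertex → Vertex → Set
  Adjacent v w = ∃[ h ] inc h ≡ v × inc (opp h) ≡ w

  Connected : Vertex → Vertex → Set
  Connected = Star Adjacent

FourRegular : Multigraph → Set
FourRegular F = ∀ v → degree v ≡ 4
  where open Multigraph F

module _ (F : Multigraph) where
  open Multigraph F

  -- A circuit partition is given by its transitions: splitting the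
  -- half-edges at each vertex into disjoint pairs amounts to a
  -- fixed-point-free involution that preserves the incident vertex.
  record CircuitPartition : Set where
    field
      partner            : HalfEdge → HalfEdge
      partner-involutive : ∀ h → partner (partner h) ≡ h
      partner-fixfree    : ∀ h → partner h ≢ h
      partner-inc        : ∀ h → inc (partner h) ≡ inc h

    -- A walk is recorded by the half-edges along which it leaves its
    -- successive vertices: leaving along h it arrives along opp h, and
    -- leaves again along the partner of opp h.
    next : HalfEdge → HalfEdge
    next h = partner (opp h)

    walk : HalfEdge → ℕ → HalfEdge
    walk = iterate next

module _ {F : Multigraph} where
  open Multigraph F
  open CircuitPartition

  -- P and Q involve the same transition at v.
  SameTransition : (P Q : CircuitPartition F) → Vertex → Set
  SameTransition P Q v = ∀ h → inc h ≡ v → partner P h ≡ partner Q h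

  Compatible : (P Q : CircuitPartition F) → Set
  Compatible P Q = ∀ v → ¬ SameTransition P Q v

------------------------------------------------------------------------
-- Circuits

  -- A circuit of P with a chosen starting point and orientation; these
  -- choices are forgotten by _≈_ below.
  record IsCircuit (P : CircuitPartition F) (h : HalfEdge) (ℓ : ℕ) : Set where
    constructor isCircuit
    field
      nonempty       : 0 < ℓ
      closed         : walk P h ℓ ≡ h
      noRepeatedEdge : (i j : Fin ℓ) →
                       SameEdge (walk P h (toℕ i)) (walk P h (toℕ j)) → i ≡ j

  record Circuit (P : CircuitPartition F) : Set where
    constructor circuit
    field
      start  : HalfEdge
      len    : ℕ
      proper : IsCircuit P start len

    Position : Set
    Position = Fin len

    out : Position → HalfEdge
    out i = walk P start (toℕ i)

    vertex : Position → Vertex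
    vertex i = inc (out i)

    OutDirected : HalfEdge → Set
    OutDirected h = ∃[ i ] out i ≡ h

    InDirected : HalfEdge → Set
    InDirected h = ∃[ i ] opp (out i) ≡ h

    ContainsEdgeOf : HalfEdge → Set
    ContainsEdgeOf h = ∃[ i ] SameEdge (out i) h

    PassesThrough : Vertex → Set
    PassesThrough v = ∃[ i ] vertex i ≡ v

    LiesInComponentOf : Vertex → Set
    LiesInComponentOf v = Connected v (inc start)

  open Circuit

  -- Circuits of one partition are edge-disjoint or equal, so they are
  -- identified, up to starting point and orientation, by their edges.
  _≈_ : {P : CircuitPartition F} → Circuit P → Circuit P → Set
  c ≈ d = ∀ h → ContainsEdgeOf c h ⇔ ContainsEdgeOf d h

  IsEulerSystem : CircuitPartition F → Set
  IsEulerSystem P = ∀ v → ∃! _≈_ λ (c : Circuit P) → LiesInComponentOf c v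

------------------------------------------------------------------------
-- Interlacement

  Interlaced : CircuitPartition F → Vertex → Vertex → Set
  Interlaced C v w = v ≢ w × ∃[ c ] OrderVWVW c
    where
    OrderVWVW : Circuit C → Set
    OrderVWVW c = ∃[ i ] ∃[ j ] ∃[ k ] ∃[ l ]
      (i Fin.< j × j Fin.< k × k Fin.< l) ×
      (vertex c i ≡ v × vertex c j ≡ w × vertex c k ≡ v × vertex c l ≡ w)

------------------------------------------------------------------------
-- Transition labels

  data Label : Set where
    φ χ ψ : Label

  -- HasLabel C P v x: the transition of P at v is labeled x with
  -- respect to C.  For an Euler system C every half-edge at v is in- or
  -- out-directed, but not both, on any circuit of C through v.
  HasLabel : (C P : CircuitPartition F) → Vertex → Label → Set
  HasLabel C P v φ = SameTransition P C v
  HasLabel C P v χ = ¬ SameTransition P C v ×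
    ∃ λ (c : Circuit C) → PassesThrough c v × ∀ h → inc h ≡ v →
      (InDirected c h → OutDirected c (partner P h)) ×
      (OutDirected c h → InDirected c (partner P h))
  HasLabel C P v ψ =
    ∃ λ (c : Circuit C) → PassesThrough c v × ∀ h → inc h ≡ v →
      (InDirected c h → InDirected c (partner P h)) ×
      (OutDirected c h → OutDirected c (partner P h))

------------------------------------------------------------------------
-- Decidability

  sameEdge? : ∀ g h → Dec (SameEdge g h)
  sameEdge? g h = (g ≟ h) ⊎-dec (g ≟ opp h)

  sameTransition? : ∀ P Q v → Dec (SameTransition P Q v)
  sameTransition? P Q v = all? λ h → (inc h ≟ v) →-dec (partner P h ≟ partner Q h)

  isCircuit? : ∀ P h ℓ → Dec (IsCircuit P h ℓ)
  isCircuit? P h ℓ = map′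
    (λ (p , q , r) → isCircuit p q r)
    (λ (isCircuit p q r) → p , q , r)
    ((0 ℕ.<? ℓ) ×-dec (walk P h ℓ ≟ h) ×-dec
     all? (λ i → all? λ j →
       sameEdge? (walk P h (toℕ i)) (walk P h (toℕ j)) →-dec (i ≟ j)))

  len≤#halfEdges : ∀ {P} (c : Circuit P) → len c ≤ #halfEdges
  len≤#halfEdges c = injective⇒≤ {f = out c}
    λ {i} {j} eq → IsCircuit.noRepeatedEdge (proper c) i j (inj₁ eq)

  anyCircuit? : ∀ {P} {Q : Circuit P → Set} → (∀ c → Dec (Q c)) →
                (∀ {h ℓ} {p q : IsCircuit P h ℓ} →
                  Q (circuit h ℓ p) → Q (circuit h ℓ q)) →
                Dec (∃ Q)
  anyCircuit? {P} {Q} Q? irrelevant = map′ to from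
    (any? λ h → any? λ (ℓ : Fin (suc #halfEdges)) → circuitWithQ? h (toℕ ℓ))
    where
    CircuitWithQ : HalfEdge → ℕ → Set
    CircuitWithQ h ℓ = ∃ λ (p : IsCircuit P h ℓ) → Q (circuit h ℓ p)

    circuitWithQ? : ∀ h ℓ → Dec (CircuitWithQ h ℓ)
    circuitWithQ? h ℓ with isCircuit? P h ℓ
    ... | no ¬p = no λ (p , _) → ¬p p
    ... | yes p = map′ (p ,_) (λ (_ , q) → irrelevant q) (Q? (circuit h ℓ p))

    to : (∃[ h ] ∃ λ (ℓ : Fin (suc #halfEdges)) → CircuitWithQ h (toℕ ℓ)) → ∃ Q
    to (h , ℓ , p , q) = circuit h (toℕ ℓ) p , q

    from : ∃ Q → ∃[ h ] ∃ λ (ℓ : Fin (suc #halfEdges)) → CircuitWithQ h (toℕ ℓ)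
    from (c , q) = start c , fromℕ< len<1+m ,
      subst (CircuitWithQ (start c)) (sym (toℕ-fromℕ< len<1+m)) (proper c , q)
      where
      len<1+m : len c < suc #halfEdges
      len<1+m = s≤s (len≤#halfEdges c)

  outDirected? : ∀ {P} (c : Circuit P) h → Dec (OutDirected c h)
  outDirected? c h = any? λ i → out c i ≟ h

  inDirected? : ∀ {P} (c : Circuit P) h → Dec (InDirected c h)
  inDirected? c h = any? λ i → opp (out c i) ≟ h

  interlaced? : ∀ C v w → Dec (Interlaced C v w)
  interlaced? C v w = ¬? (v ≟ w) ×-dec anyCircuit?
    (λ c → any? λ i → any? λ j → any? λ k → any? λ l →
      ((i <? j) ×-dec (j <? k) ×-dec (k <? l)) ×-dec
      ((vertex c i ≟ v) ×-dec (vertex c j ≟ w) ×-dec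
       (vertex c k ≟ v) ×-dec (vertex c l ≟ w)))
    (λ q → q)

  hasLabel? : ∀ C P v x → Dec (HasLabel C P v x)
  hasLabel? C P v φ = sameTransition? P C v
  hasLabel? C P v χ = ¬? (sameTransition? P C v) ×-dec anyCircuit?
    (λ c → any? (λ i → vertex c i ≟ v) ×-dec
      all? λ h → (inc h ≟ v) →-dec
        ((inDirected? c h →-dec outDirected? c (partner P h)) ×-dec
         (outDirected? c h →-dec inDirected? c (partner P h))))
    (λ q → q)
  hasLabel? C P v ψ = anyCircuit?
    (λ c → any? (λ i → vertex c i ≟ v) ×-dec
      all? λ h → (inc h ≟ v) →-dec
        ((inDirected? c h →-dec inDirected? c (partner P h)) ×-dec
         (outDirected? c h →-dec outDirected? c (partner P h))))
    (λ q → q)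

------------------------------------------------------------------------
-- Interlacement matrices

  ℐ : CircuitPartition F → Matrix #vertices
  ℐ C v w = does (interlaced? C v w)

  -- ℐ[ P ] C is the interlacement matrix of C relative to P.
  ℐ[_]_ : CircuitPartition F → CircuitPartition F → Matrix #vertices
  (ℐ[ P ] C) v w =
    if does (v ≟ w) then has φ v ∨ has ψ v
    else if has φ v ∨ has φ w then GF2.0#
    else ℐ C v w
    where
    has : Label → Vertex → Bool
    has x u = does (hasLabel? C P u x)

{-# OPTIONS --safe #-}
module Submission where

-- A GF(2)-valued function f on edges (a function on half-edges invariant
-- under opp) has, with respect to a transition system P, a jump
-- f h + f (partner P h) at each half-edge h.  When the jump depends only
-- on the vertex of h, it is a vector indexed by the vertices.
--
-- Let C be an Euler system.  An edge function without jumps along C is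
-- constant on each circuit of C, hence takes the same value on all the
-- half-edges at a vertex (invariant⇒constant).  So the jumps of f along
-- C determine its jumps along every other P (jumps-determine), and this
-- dependence is linear.  Its matrix is found from the indicator functions
-- of arcs: an arc of C from one visit of v to the other jumps along C
-- exactly at v (arc-hasJumps).  If P involves at no vertex the transition
-- of C, then the jumps of such an arc along P form the row v of ℐ[ P ] C
-- (jump-entry): at w different from v the arc contains exactly one of the
-- two passages through w when v and w are interlaced, and both or neither
-- otherwise; at v the arc starts along one outgoing half-edge and ends
-- before the other, so that it jumps along the ψ transition and not along
-- the χ transition.  Hence jumps a along C become jumps a · ℐ[ P ] C
-- along P (jumps-transfer), for row vectors a.
--
-- An edge function whose jumps along C′ are the unit vector at v has the
-- jumps e · ℐ[ C ] C′ along C, then e · ℐ[ C ] C′ · ℐ[ C″ ] C along C″,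
-- and then e · ℐ[ C ] C′ · ℐ[ C″ ] C · ℐ[ C′ ] C″ along C′ again, where e
-- is that unit vector.  The last vector is therefore e.

open import Defs
open import Algebra.Properties.Semiring.Sum GF2.semiring
  using (sum-cong-≗; ∑-distrib-+)
open import Data.Bool.Base using (Bool; true; false; _∨_; _∧_; _xor_; if_then_else_)
open import Data.Bool.Properties as Bool
  using (xor-same; xor-identityʳ; ∧-zeroʳ; ∧-identityʳ; ∧-distribˡ-xor)
open import Data.Bool.Solver using (module xor-∧-Solver)
open import Data.Fin.Base as Fin using (Fin; zero; suc; toℕ; fromℕ<)
open import Data.Fin.Properties as Fin
  using (_≟_; toℕ<n; toℕ-fromℕ<; pigeonhole; ¬∀⟶∃¬-smallest; toℕ-inject)
open import Data.List.Base as List using (List; []; _∷_; length; lookup; allFin)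
open import Data.List.Membership.DecPropositional using (_∈?_)
open import Data.List.Membership.Propositional using (_∈_)
open import Data.List.Membership.Propositional.Properties
  using (∈-filter⁺; ∈-filter⁻; ∈-allFin; ∈-lookup)
open import Data.List.Membership.Setoid.Properties using (index-injective)
open import Data.List.Relation.Unary.All as All using (All; []; _∷_)
open import Data.List.Relation.Unary.All.Properties using (¬Any⇒All¬)
open import Data.List.Relation.Unary.Any using (here; there; index)
open import Data.List.Relation.Unary.AllPairs using ([]; _∷_)
open import Data.List.Relation.Unary.Unique.Propositional using (Unique)
open import Data.Nat.Base using (ℕ; zero; suc; _+_; _∸_; _≤_; _<_; z≤n; s≤s)
open import Data.Nat.GeneralisedArithmetic using (iterate)
import Data.Nat.Properties as ℕ
open import Data.Product using (∃-syntax; _×_; _,_; proj₁; proj₂)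
open import Data.Sum.Base using (_⊎_; inj₁; inj₂)
open import Function.Base using (_∘_; case_of_)
open import Function.Bundles using (mk⇔; Equivalence)
open import Relation.Binary.Construct.Closure.ReflexiveTransitive using (ε)
open import Relation.Binary.Definitions using (tri<; tri≈; tri>)
open import Relation.Binary.PropositionalEquality
  using (_≡_; _≢_; refl; sym; trans; cong; cong₂; subst; setoid; ≢-sym; module ≡-Reasoning)
open import Relation.Nullary.Decidable
  using (Dec; yes; no; does; ¬?; dec-true; dec-false; does-⇔; decidable-stable)
open import Relation.Nullary.Negation using (¬_; contradiction)

private variable
  A : Set

-- Iteration, counting and sums over GF(2)

iterate-+ : ∀ (f : A → A) x m n →
            iterate f x (m + n) ≡ iterate f (iterate f x m) n
iterate-+ f x zero    n = refl
iterate-+ f x (suc m) n = iterate-+ f (f x) m n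

iterate-suc : ∀ (f : A → A) x n → iterate f x (suc n) ≡ f (iterate f x n)
iterate-suc f x zero    = refl
iterate-suc f x (suc n) = iterate-suc f (f x) n

Unique⇒lookup-≢ : ∀ {xs : List A} → Unique xs → ∀ {i j} → i Fin.< j →
                  lookup xs i ≢ lookup xs j
Unique⇒lookup-≢ (x≢ ∷ _) {zero}  {suc j} _         = All.lookup x≢ (∈-lookup j)
Unique⇒lookup-≢ (_ ∷ u)  {suc i} {suc j} (s≤s i<j) = Unique⇒lookup-≢ u i<j

Unique-⊆⇒length-≤ : ∀ {xs ys : List A} → Unique xs → All (_∈ ys) xs →
                    length xs ≤ length ys
Unique-⊆⇒length-≤ {xs = xs} {ys} u xs⊆ys = ℕ.≮⇒≥ λ ys<xs →
  let i , j , i<j , eq = pigeonhole ys<xs (λ i → index (∈ys i))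
  in Unique⇒lookup-≢ u i<j (index-injective (setoid _) (∈ys i) (∈ys j) eq)
  where
  ∈ys : ∀ i → lookup xs i ∈ ys
  ∈ys i = All.lookup xs⊆ys (∈-lookup i)

xor-injectiveʳ : ∀ x y z → x xor y ≡ x xor z → y ≡ z
xor-injectiveʳ false _     _     eq   = eq
xor-injectiveʳ true  false false _    = refl
xor-injectiveʳ true  true  true  _    = refl

xor-exchange : ∀ p q r s → p xor q ≡ r xor s → p xor r ≡ q xor s
xor-exchange p q r s eq = begin
  p xor r                  ≡⟨ insert p q r ⟩
  (p xor q) xor (q xor r)  ≡⟨ cong (_xor (q xor r)) eq ⟩
  (r xor s) xor (q xor r)  ≡⟨ drop q r s ⟩
  q xor s                  ∎
  where
  open ≡-Reasoning
  open xor-∧-Solver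
  insert : ∀ p q r → p xor r ≡ (p xor q) xor (q xor r)
  insert = solve 3 (λ p q r → p :+ r := (p :+ q) :+ (q :+ r)) refl
  drop : ∀ q r s → (r xor s) xor (q xor r) ≡ q xor s
  drop = solve 3 (λ q r s → (r :+ s) :+ (q :+ r) := q :+ s) refl

sum-zero : ∀ n → sum {n} (λ _ → false) ≡ false
sum-zero zero    = refl
sum-zero (suc n) = sum-zero n

-- A row vector times the identity matrix.
sum-∧-𝟙 : ∀ {n} (a : Fin n → Bool) w → sum (λ v → a v ∧ 𝟙 v w) ≡ a w
sum-∧-𝟙 {suc n} a zero = begin
  (a zero ∧ true) xor sum (λ v → a (suc v) ∧ false)
    ≡⟨ cong₂ _xor_ (∧-identityʳ (a zero))
         (trans (sum-cong-≗ {n} (∧-zeroʳ ∘ a ∘ suc)) (sum-zero n)) ⟩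
  a zero xor false ≡⟨ xor-identityʳ (a zero) ⟩
  a zero           ∎
  where open ≡-Reasoning
sum-∧-𝟙 {suc n} a (suc w) = begin
  (a zero ∧ false) xor sum (λ v → a (suc v) ∧ 𝟙 v w)
    ≡⟨ cong (_xor sum (λ v → a (suc v) ∧ 𝟙 v w)) (∧-zeroʳ (a zero)) ⟩
  sum (λ v → a (suc v) ∧ 𝟙 v w)  ≡⟨ sum-∧-𝟙 (a ∘ suc) w ⟩
  a (suc w)                      ∎
  where open ≡-Reasoning

𝟙-refl : ∀ {n} (v : Fin n) → 𝟙 v v ≡ true
𝟙-refl v rewrite dec-true (v ≟ v) refl = refl

𝟙-≢ : ∀ {n} {v w : Fin n} → v ≢ w → 𝟙 v w ≡ false
𝟙-≢ {v = v} {w} v≢w rewrite dec-false (v ≟ w) v≢w = refl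

module _ {F : Multigraph} where
  open Multigraph F
  open CircuitPartition
  open Circuit

-- Walks

  opp-injective : ∀ {x y} → opp x ≡ opp y → x ≡ y
  opp-injective {x} {y} eq =
    trans (sym (opp-involutive x)) (trans (cong opp eq) (opp-involutive y))

  module _ (P : CircuitPartition F) where

    partner-injective : ∀ {x y} → partner P x ≡ partner P y → x ≡ y
    partner-injective {x} {y} eq =
      trans (sym (partner-involutive P x)) (trans (cong (partner P) eq) (partner-involutive P y))

    partner-flip : ∀ {x y} → partner P x ≡ y → x ≡ partner P y
    partner-flip {x} eq = trans (sym (partner-involutive P x)) (cong (partner P) eq)

    walk-+ : ∀ h m n → walk P h (m + n) ≡ walk P (walk P h m) n
    walk-+ = iterate-+ (next P)

    walk-suc : ∀ h n → walk P h (suc n) ≡ next P (walk P h n)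
    walk-suc = iterate-suc (next P)

    walk-∸ : ∀ h {i k} → i ≤ k → walk P (walk P h i) (k ∸ i) ≡ walk P h k
    walk-∸ h {i} {k} i≤k =
      trans (sym (walk-+ h i (k ∸ i))) (cong (walk P h) (ℕ.m+[n∸m]≡n i≤k))

    walk-injective : ∀ n {x y} → walk P x n ≡ walk P y n → x ≡ y
    walk-injective zero    eq = eq
    walk-injective (suc n) eq =
      opp-injective (partner-injective (walk-injective n eq))

    -- opp and partner are involutions with composite next, so they act as
    -- the reflections of a dihedral group.  If a power of next agreed at x
    -- with one of them, then opp or partner would have a fixed point halfway
    -- along the walk.  The induction shortens the walk at both ends.
    walk-≢-opp : ∀ n x → walk P x n ≢ opp x
    walk-≢-opp zero          x eq = opp-fixfree x (sym eq)
    walk-≢-opp (suc zero)    x eq = partner-fixfree P (opp x) eq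
    walk-≢-opp (suc (suc n)) x eq = walk-≢-opp n (next P x) (opp-injective (begin
      opp (walk P (next P x) n)                         ≡⟨ partner-involutive P _ ⟨
      partner P (next P (walk P (next P x) n))          ≡⟨ cong (partner P) (walk-suc (next P x) n) ⟨
      partner P (walk P x (suc (suc n)))                ≡⟨ cong (partner P) eq ⟩
      next P x                                          ≡⟨ opp-involutive _ ⟨
      opp (opp (next P x))                              ∎))
      where open ≡-Reasoning

    walk-≢-partner : ∀ n x → walk P x n ≢ partner P x
    walk-≢-partner zero          x eq = partner-fixfree P x (sym eq)
    walk-≢-partner (suc zero)    x eq = opp-fixfree x (partner-injective eq)
    walk-≢-partner (suc (suc n)) x eq = walk-≢-partner n (next P x) (opp-injective (begin
      opp (walk P (next P x) n)                 ≡⟨ partner-injective (trans (sym (walk-suc (next P x) n)) eq) ⟩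
      x                                         ≡⟨ opp-involutive x ⟨
      opp (opp x)                               ≡⟨ cong opp (partner-involutive P (opp x)) ⟨
      opp (partner P (next P x))                ∎))
      where open ≡-Reasoning

    -- A walk never traverses an edge in both directions.
    walk-≢-opp-walk : ∀ h i j → walk P h i ≢ opp (walk P h j)
    walk-≢-opp-walk h i j eq with ℕ.≤-total i j
    ... | inj₁ i≤j = walk-≢-opp (j ∸ i) (walk P h i)
      (trans (walk-∸ h i≤j) (trans (sym (opp-involutive _)) (cong opp (sym eq))))
    ... | inj₂ j≤i = walk-≢-opp (i ∸ j) (walk P h j) (trans (walk-∸ h j≤i) eq)

    -- A walk never leaves a vertex along both half-edges of a pair.
    walk-≢-partner-walk : ∀ h i j → walk P h i ≢ partner P (walk P h j)
    walk-≢-partner-walk h i j eq with ℕ.≤-total i j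
    ... | inj₁ i≤j = walk-≢-partner (j ∸ i) (walk P h i)
      (trans (walk-∸ h i≤j) (trans (sym (partner-involutive P _)) (cong (partner P) (sym eq))))
    ... | inj₂ j≤i = walk-≢-partner (i ∸ j) (walk P h j) (trans (walk-∸ h j≤i) eq)

    walk-invariant : ∀ {g : HalfEdge → A} → (∀ h → g (opp h) ≡ g h) →
                     (∀ h → g (partner P h) ≡ g h) → ∀ h n → g (walk P h n) ≡ g h
    walk-invariant opp-inv partner-inv h zero    = refl
    walk-invariant opp-inv partner-inv h (suc n) =
      trans (walk-invariant opp-inv partner-inv (next P h) n)
            (trans (partner-inv (opp h)) (opp-inv h))

    walk-return : ∀ h {i j} → i ≤ j → walk P h i ≡ walk P h j → walk P h (j ∸ i) ≡ h
    walk-return h {i} {j} i≤j eq = walk-injective i (begin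
      walk P (walk P h (j ∸ i)) i  ≡⟨ walk-+ h (j ∸ i) i ⟨
      walk P h (j ∸ i + i)         ≡⟨ cong (walk P h) (ℕ.m∸n+n≡m i≤j) ⟩
      walk P h j                   ≡⟨ eq ⟨
      walk P h i                   ∎)
      where open ≡-Reasoning

-- Circuits

    -- The least positive period of the walk from h, as the successor of n.
    minimalPeriod : ∀ h → ∃[ n ] walk P h (suc n) ≡ h ×
                    (∀ {m} → m < n → walk P h (suc m) ≢ h)
    minimalPeriod h =
      let i , ¬¬returns , minimal = ¬∀⟶∃¬-smallest #halfEdges NotBack
            (λ i → ¬? (walk P h (suc (toℕ i)) ≟ h)) ¬never
      in toℕ i , decidable-stable (_ ≟ h) ¬¬returns , λ {m} m<i returns →
         minimal (fromℕ< m<i)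
           (subst (λ k → walk P h (suc k) ≡ h)
             (sym (trans (toℕ-inject (fromℕ< m<i)) (toℕ-fromℕ< m<i))) returns)
      where
      NotBack : Fin #halfEdges → Set
      NotBack i = walk P h (suc (toℕ i)) ≢ h
      ¬never : ¬ (∀ i → NotBack i)
      ¬never never with pigeonhole (ℕ.n<1+n #halfEdges) (λ i → walk P h (toℕ i))
      ... | i , suc j , s≤s i≤j , eq = never (fromℕ< j∸i<#)
        (subst (λ k → walk P h k ≡ h) (begin
          suc (toℕ j) ∸ toℕ i         ≡⟨ ℕ.+-∸-assoc 1 i≤j ⟩
          suc (toℕ j ∸ toℕ i)         ≡⟨ cong suc (toℕ-fromℕ< j∸i<#) ⟨
          suc (toℕ (fromℕ< j∸i<#))    ∎)
          (walk-return h (ℕ.m≤n⇒m≤1+n i≤j) eq))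
        where
        open ≡-Reasoning
        j∸i<# : toℕ j ∸ toℕ i < #halfEdges
        j∸i<# = ℕ.≤-<-trans (ℕ.m∸n≤m (toℕ j) (toℕ i)) (toℕ<n j)

    -- The circuit of P that starts along h.
    circuitFrom : HalfEdge → Circuit P
    circuitFrom h = circuit h (suc n) (isCircuit (s≤s z≤n) returns noRepeat)
      where
      n = proj₁ (minimalPeriod h)
      returns = proj₁ (proj₂ (minimalPeriod h))

      ¬early : ∀ {i j} → i < j → j < suc n → walk P h i ≢ walk P h j
      ¬early {i} {suc j} (s≤s i≤j) (s≤s j<n) eq =
        proj₂ (proj₂ (minimalPeriod h)) {j ∸ i} j∸i<n
          (subst (λ k → walk P h k ≡ h) (ℕ.+-∸-assoc 1 i≤j)
            (walk-return h (ℕ.m≤n⇒m≤1+n i≤j) eq))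
        where
        j∸i<n : j ∸ i < n
        j∸i<n = ℕ.≤-<-trans (ℕ.m∸n≤m j i) j<n

      noRepeat : (i j : Fin (suc n)) →
                 SameEdge (walk P h (toℕ i)) (walk P h (toℕ j)) → i ≡ j
      noRepeat i j (inj₂ eq) = contradiction eq (walk-≢-opp-walk h (toℕ i) (toℕ j))
      noRepeat i j (inj₁ eq) with Fin.<-cmp i j
      ... | tri< i<j _ _ = contradiction eq (¬early i<j (toℕ<n j))
      ... | tri≈ _ i≡j _ = i≡j
      ... | tri> _ _ j<i = contradiction (sym eq) (¬early j<i (toℕ<n i))

  module _ {P : CircuitPartition F} (c : Circuit P) where
    open IsCircuit (proper c)

    out-next : ∀ {x} → OutDirected c x → OutDirected c (next P x)
    out-next (i , refl) with ℕ.m≤n⇒m<n∨m≡n (toℕ<n i)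
    ... | inj₁ 1+i<len = fromℕ< 1+i<len ,
      trans (cong (walk P (start c)) (toℕ-fromℕ< 1+i<len)) (walk-suc P (start c) (toℕ i))
    ... | inj₂ 1+i≡len = fromℕ< nonempty , (begin
      walk P (start c) (toℕ (fromℕ< nonempty)) ≡⟨ cong (walk P (start c)) (toℕ-fromℕ< nonempty) ⟩
      start c                                  ≡⟨ closed ⟨
      walk P (start c) (len c)                 ≡⟨ cong (walk P (start c)) 1+i≡len ⟨
      walk P (start c) (suc (toℕ i))           ≡⟨ walk-suc P (start c) (toℕ i) ⟩
      next P (out c i)                         ∎)
      where open ≡-Reasoning

    out-walk : ∀ n {x} → OutDirected c x → OutDirected c (walk P x n)
    out-walk zero    o = o
    out-walk (suc n) o = out-walk n (out-next o)

    -- At the starting point the predecessor is the last position.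
    out-predecessor : ∀ {x} → OutDirected c x → ∃[ i ] next P (out c i) ≡ x
    out-predecessor (i , refl) = pred (toℕ i) refl
      where
      at : ∀ {k} → suc k ≤ len c → ∃[ i ] next P (out c i) ≡ walk P (start c) (suc k)
      at {k} k<len = fromℕ< k<len , trans
        (cong (next P ∘ walk P (start c)) (toℕ-fromℕ< k<len)) (sym (walk-suc P (start c) k))
      last : ∀ n → len c ≡ n → 0 < n → ∃[ i ] next P (out c i) ≡ start c
      last (suc k) eq _ =
        let i , e = at {k} (ℕ.≤-reflexive (sym eq))
        in i , trans e (trans (cong (walk P (start c)) (sym eq)) closed)
      pred : ∀ k → k ≡ toℕ i → ∃[ i ] next P (out c i) ≡ walk P (start c) k
      pred zero    eq = last (len c) refl nonempty
      pred (suc k) eq = at (ℕ.<⇒≤ (subst (_< len c) (sym eq) (toℕ<n i)))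

    in⇒partner-out : ∀ {x} → InDirected c x → OutDirected c (partner P x)
    in⇒partner-out (i , refl) = out-next (i , refl)

    partner-out⇒in : ∀ {x} → OutDirected c (partner P x) → InDirected c x
    partner-out⇒in o = let i , eq = out-predecessor o in i , partner-injective P eq

    out⇒partner-not-out : ∀ {x} → OutDirected c x → ¬ OutDirected c (partner P x)
    out⇒partner-not-out (i , refl) (j , eq) =
      walk-≢-partner-walk P (start c) (toℕ j) (toℕ i) eq

    -- If z lies on the edge of an out-directed half-edge, then that edge either
    -- leaves along z or arrives along z and is followed by partner P z.
    contains⇒out : ∀ {x z} → OutDirected c x → SameEdge x z →
                   OutDirected c z ⊎ OutDirected c (partner P z)
    contains⇒out o (inj₁ refl) = inj₁ o
    contains⇒out {z = z} o (inj₂ refl) =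
      inj₂ (subst (OutDirected c ∘ partner P) (opp-involutive z) (out-next o))

    walk-positions : ∀ {i j} → i < len c → j < len c →
                     walk P (start c) i ≡ walk P (start c) j → i ≡ j
    walk-positions {i} {j} i< j< eq = begin
      i                ≡⟨ toℕ-fromℕ< i< ⟨
      toℕ (fromℕ< i<)  ≡⟨ cong toℕ (noRepeatedEdge (fromℕ< i<) (fromℕ< j<) (inj₁ (begin
          walk P (start c) (toℕ (fromℕ< i<)) ≡⟨ cong (walk P (start c)) (toℕ-fromℕ< i<) ⟩
          walk P (start c) i                 ≡⟨ eq ⟩
          walk P (start c) j                 ≡⟨ cong (walk P (start c)) (toℕ-fromℕ< j<) ⟨
          walk P (start c) (toℕ (fromℕ< j<)) ∎))) ⟩
      toℕ (fromℕ< j<)  ≡⟨ toℕ-fromℕ< j< ⟩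
      j                ∎
      where open ≡-Reasoning

-- Euler systems

  module _ {P : CircuitPartition F} (euler : IsEulerSystem P) where

    -- Circuits through the same vertex lie in the same component, so the
    -- circuits from h and from h′ have the same edges.
    contains-edges-at-start : ∀ {h h′} → inc h ≡ inc h′ → ContainsEdgeOf (circuitFrom P h) h′
    contains-edges-at-start {h} {h′} eq with euler (inc h)
    ... | c , _ , unique = Equivalence.to (unique {circuitFrom P h} ε h′)
      (Equivalence.from (unique {circuitFrom P h′} (subst (λ v → Connected v (inc h′)) (sym eq) ε) h′)
        (zero , inj₁ refl))

    invariant⇒constant : ∀ {g : HalfEdge → A} → (∀ h → g (opp h) ≡ g h) →
                         (∀ h → g (partner P h) ≡ g h) →
                         ∀ {x y} → inc x ≡ inc y → g x ≡ g y
    invariant⇒constant {g = g} opp-inv partner-inv {x} {y} eq with contains-edges-at-start eq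
    ... | i , inj₁ e = trans (sym (walk-invariant P opp-inv partner-inv x (toℕ i))) (cong g e)
    ... | i , inj₂ e = trans (sym (walk-invariant P opp-inv partner-inv x (toℕ i)))
                             (trans (cong g e) (opp-inv y))

    -- A circuit that leaves inc x along x passes through every pair of
    -- half-edges at that vertex, in one of the two directions.
    passes-each-pair : ∀ (c : Circuit P) {x y} → OutDirected c x → inc x ≡ inc y →
                   OutDirected c y ⊎ OutDirected c (partner P y)
    passes-each-pair c o eq =
      let i , same = contains-edges-at-start eq
      in contains⇒out c (out-walk c (toℕ i) o) same

-- Edge functions and their jumps

  -- f is an edge function whose jumps along P form the vector a.  For an
  -- arbitrary edge function the two pairs of P at a vertex may have different
  -- jumps; that they agree is part of the notion.
  record HasJumps (P : CircuitPartition F) (a : Vertex → Bool) (f : HalfEdge → Bool) : Set where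
    field
      opp-invariant : ∀ h → f (opp h) ≡ f h
      jump          : ∀ h → f h xor f (partner P h) ≡ a (inc h)

    no-jump : ∀ {h} → a (inc h) ≡ false → f (partner P h) ≡ f h
    no-jump {h} eq = sym (xor-injectiveʳ (f h) _ _
      (trans (xor-same (f h)) (sym (trans (jump h) eq))))

  open HasJumps

  -- The sum f + f′ has no jump along C, hence is constant at each vertex.
  jumps-determine : ∀ {C a f f′} → IsEulerSystem C → HasJumps C a f → HasJumps C a f′ →
                    ∀ {x y} → inc x ≡ inc y → f x xor f y ≡ f′ x xor f′ y
  jumps-determine {C} {a} {f} {f′} euler J J′ {x} {y} eq =
    xor-exchange (f x) (f′ x) (f y) (f′ y)
      (invariant⇒constant euler {g = λ h → f h xor f′ h}
        (λ h → cong₂ _xor_ (opp-invariant J h) (opp-invariant J′ h))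
        (λ h → sym (xor-exchange (f h) (f (partner C h)) (f′ h) (f′ (partner C h))
                     (trans (jump J h) (sym (jump J′ h)))))
        eq)

-- Arcs

  module _ (P : CircuitPartition F) where

    -- The indicator function over GF(2) of the first m edges of the walk from h,
    -- counted with multiplicity.
    arc : HalfEdge → ℕ → HalfEdge → Bool
    arc h zero    x = false
    arc h (suc m) x = (does (h ≟ x) xor does (opp h ≟ x)) xor arc (next P h) m x

    -- The indicator function of the pair h, partner P h.
    ends : HalfEdge → HalfEdge → Bool
    ends h x = does (h ≟ x) xor does (h ≟ partner P x)

    ends-self : ∀ h → ends h h ≡ true
    ends-self h = cong₂ _xor_ (dec-true (h ≟ h) refl)
      (dec-false (h ≟ partner P h) (≢-sym (partner-fixfree P h)))

    ends-partner : ∀ h → ends h (partner P h) ≡ true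
    ends-partner h = cong₂ _xor_ (dec-false (h ≟ partner P h) (≢-sym (partner-fixfree P h)))
      (dec-true (h ≟ _) (sym (partner-involutive P h)))

    ends-other : ∀ {h x} → h ≢ x → h ≢ partner P x → ends h x ≡ false
    ends-other {h} {x} h≢x h≢Px =
      cong₂ _xor_ (dec-false (h ≟ x) h≢x) (dec-false (h ≟ partner P x) h≢Px)

    arc-opp-invariant : ∀ m h x → arc h m (opp x) ≡ arc h m x
    arc-opp-invariant zero    h x = refl
    arc-opp-invariant (suc m) h x = cong₂ _xor_
      (trans (cong₂ _xor_ (does-⇔ (mk⇔ (λ { refl → opp-involutive x }) (λ { refl → sym (opp-involutive h) }))
                             (h ≟ opp x) (opp h ≟ x))
                          (does-⇔ (mk⇔ opp-injective (cong opp)) (opp h ≟ opp x) (h ≟ x)))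
             (Bool.xor-comm (does (opp h ≟ x)) (does (h ≟ x))))
      (arc-opp-invariant m (next P h) x)

    -- The jumps within the arc cancel: next P h is the partner of opp h, so each
    -- edge ends in the pair in which the following edge starts.
    arc-jump : ∀ m h x → arc h m x xor arc h m (partner P x) ≡ ends h x xor ends (walk P h m) x
    arc-jump zero    h x = sym (xor-same (ends h x))
    arc-jump (suc m) h x = begin
      ((p xor q) xor r) xor ((s xor t) xor u)
        ≡⟨ rearrange p q r s t u ⟩
      ((p xor s) xor (t xor q)) xor (r xor u)
        ≡⟨ cong₂ (λ b c → ((p xor s) xor b) xor c) (cong₂ _xor_ t≡ q≡) (arc-jump m (next P h) x) ⟩
      (ends h x xor ends (next P h) x) xor (ends (next P h) x xor ends (walk P h (suc m)) x)
        ≡⟨ cancel (ends h x) (ends (next P h) x) (ends (walk P h (suc m)) x) ⟩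
      ends h x xor ends (walk P h (suc m)) x ∎
      where
      open ≡-Reasoning
      open xor-∧-Solver
      p = does (h ≟ x)
      q = does (opp h ≟ x)
      r = arc (next P h) m x
      s = does (h ≟ partner P x)
      t = does (opp h ≟ partner P x)
      u = arc (next P h) m (partner P x)
      rearrange : ∀ p q r s t u → ((p xor q) xor r) xor ((s xor t) xor u) ≡
                                  ((p xor s) xor (t xor q)) xor (r xor u)
      rearrange = solve 6 (λ p q r s t u → ((p :+ q) :+ r) :+ ((s :+ t) :+ u) :=
                                           ((p :+ s) :+ (t :+ q)) :+ (r :+ u)) refl
      cancel : ∀ p q r → (p xor q) xor (q xor r) ≡ p xor r
      cancel = solve 3 (λ p q r → (p :+ q) :+ (q :+ r) := p :+ r) refl
      t≡ : t ≡ does (next P h ≟ x)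
      t≡ = does-⇔ (mk⇔ (λ e → trans (cong (partner P) e) (partner-involutive P x))
                       (λ e → trans (sym (partner-involutive P (opp h))) (cong (partner P) e)))
                  (opp h ≟ partner P x) (next P h ≟ x)
      q≡ : q ≡ does (next P h ≟ partner P x)
      q≡ = does-⇔ (mk⇔ (cong (partner P)) (partner-injective P))
                  (opp h ≟ x) (next P h ≟ partner P x)

    arc-true⇒contains : ∀ m h x → arc h m x ≡ true → ∃[ n ] SameEdge (walk P h n) x
    arc-true⇒contains (suc m) h x eq with h ≟ x | opp h ≟ x
    ... | yes h≡x | _          = 0 , inj₁ h≡x
    ... | no _    | yes opph≡x = 0 , inj₂ (trans (sym (opp-involutive h)) (cong opp opph≡x))
    ... | no _    | no _       =
      let n , same = arc-true⇒contains m (next P h) x eq in suc n , same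

    module _ (c : Circuit P) where
      private
        w : ℕ → HalfEdge
        w = walk P (start c)

        arc-step : ∀ m i x → arc (w i) (suc m) x ≡
                   does (w i ≟ x) xor does (opp (w i) ≟ x) xor arc (w (suc i)) m x
        arc-step m i x = trans (Bool.xor-assoc (does (w i ≟ x)) _ _)
          (cong (λ y → does (w i ≟ x) xor does (opp (w i) ≟ x) xor arc y m x)
                (sym (walk-suc P (start c) i)))

        not-opp : ∀ i j → does (opp (w i) ≟ w j) ≡ false
        not-opp i j = dec-false (_ ≟ _) λ e → walk-≢-opp-walk P (start c) j i (sym e)

      -- On a circuit, the arc of m edges from position i contains the edge at
      -- position j exactly when j lies in the interval from i up to, but not
      -- including, i + m.
      arc-outside : ∀ m {i j} → i + m ≤ len c → j < len c → j < i ⊎ i + m ≤ j →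
                    arc (w i) m (w j) ≡ false
      arc-outside zero _ _ _ = refl
      arc-outside (suc m) {i} {j} i+m≤ j< far = trans (arc-step m i (w j))
        (cong₂ _xor_ (dec-false (w i ≟ w j) (i≢j far ∘ walk-positions c i< j<))
          (cong₂ _xor_ (not-opp i j)
            (arc-outside m {suc i} (subst (_≤ len c) (ℕ.+-suc i m) i+m≤) j< (farther far))))
        where
        i< : i < len c
        i< = ℕ.<-≤-trans (ℕ.m<m+n i (s≤s z≤n)) i+m≤
        i≢j : j < i ⊎ i + suc m ≤ j → i ≢ j
        i≢j (inj₁ j<i)   refl = ℕ.<-irrefl refl j<i
        i≢j (inj₂ i+m≤j) refl = ℕ.<-irrefl refl (ℕ.<-≤-trans (ℕ.m<m+n i (s≤s z≤n)) i+m≤j)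
        farther : j < i ⊎ i + suc m ≤ j → j < suc i ⊎ suc i + m ≤ j
        farther (inj₁ j<i)   = inj₁ (ℕ.m≤n⇒m≤1+n j<i)
        farther (inj₂ i+m≤j) = inj₂ (subst (_≤ j) (ℕ.+-suc i m) i+m≤j)

      arc-inside : ∀ m {i j} → i + m ≤ len c → i ≤ j → j < i + m →
                   arc (w i) m (w j) ≡ true
      arc-inside zero {i} _ i≤j j<i+0 =
        contradiction (subst (_ <_) (ℕ.+-identityʳ i) j<i+0) (ℕ.≤⇒≯ i≤j)
      arc-inside (suc m) {i} {j} i+m≤ i≤j j<i+m with ℕ.m≤n⇒m<n∨m≡n i≤j
      ... | inj₂ refl = trans (arc-step m i (w i))
        (cong₂ _xor_ (dec-true (w i ≟ w i) refl)
          (cong₂ _xor_ (not-opp i i)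
            (arc-outside m {suc i} (subst (_≤ len c) (ℕ.+-suc i m) i+m≤)
              (ℕ.<-≤-trans j<i+m i+m≤) (inj₁ ℕ.≤-refl))))
      ... | inj₁ i<j = trans (arc-step m i (w j))
        (cong₂ _xor_ (dec-false (w i ≟ w j) (ℕ.<⇒≢ i<j ∘ walk-positions c (ℕ.<-trans i<j j<) j<))
          (cong₂ _xor_ (not-opp i j)
            (arc-inside m {suc i} (subst (_≤ len c) (ℕ.+-suc i m) i+m≤) i<j
              (subst (j <_) (ℕ.+-suc i m) j<i+m))))
        where
        j< : j < len c
        j< = ℕ.<-≤-trans j<i+m i+m≤

-- Four half-edges at each vertex

  module _ (regular : FourRegular F) where

    private
      halfEdgesAt : Vertex → List HalfEdge
      halfEdgesAt v = List.filter (λ h → inc h ≟ v) (allFin #halfEdges)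

    halfEdge-at : ∀ v → ∃[ h ] inc h ≡ v
    halfEdge-at v = first (halfEdgesAt v) refl (regular v)
      where
      first : ∀ hs → hs ≡ halfEdgesAt v → length hs ≡ 4 → ∃[ h ] inc h ≡ v
      first (h ∷ hs) eq _ =
        h , proj₂ (∈-filter⁻ (λ h → inc h ≟ v) {xs = allFin #halfEdges} (subst (h ∈_) eq (here refl)))

    module _ (C : CircuitPartition F) where

      -- The two pairs of C at a vertex make up all its half-edges, since a fifth
      -- half-edge would contradict the degree.
      four-halfEdges : ∀ {x y z} → inc y ≡ inc x → inc z ≡ inc x → y ≢ x → y ≢ partner C x →
                       z ∈ x ∷ partner C x ∷ y ∷ partner C y ∷ []
      four-halfEdges {x} {y} {z} y∼x z∼x y≢x y≢Cx =
        decidable-stable (_∈?_ _≟_ z quad) λ z∉ →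
          ℕ.1+n≰n (subst (5 ≤_) (regular (inc x))
            (Unique-⊆⇒length-≤ (¬Any⇒All¬ quad z∉ ∷ distinct)
              (at z∼x ∷ at refl ∷ at (partner-inc C x) ∷ at y∼x ∷ at (trans (partner-inc C y) y∼x) ∷ [])))
        where
        quad : List HalfEdge
        quad = x ∷ partner C x ∷ y ∷ partner C y ∷ []
        at : ∀ {h} → inc h ≡ inc x → h ∈ halfEdgesAt (inc x)
        at = ∈-filter⁺ (λ h → inc h ≟ inc x) (∈-allFin _)
        distinct : Unique quad
        distinct =
          (≢-sym (partner-fixfree C x) ∷ ≢-sym y≢x ∷
            (λ x≡Cy → y≢Cx (partner-flip C (sym x≡Cy))) ∷ []) ∷
          (≢-sym y≢Cx ∷ (λ e → y≢x (sym (partner-injective C e))) ∷ []) ∷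
          (≢-sym (partner-fixfree C y) ∷ []) ∷
          [] ∷ []

      -- The indicators of the two pairs at v add up to that of all half-edges at v.
      ends-at-vertex : ∀ {v h k} → inc h ≡ v → inc k ≡ v → k ≢ h → k ≢ partner C h →
                       ∀ x → ends C h x xor ends C k x ≡ 𝟙 v (inc x)
      ends-at-vertex {v} {h} {k} h∼v k∼v k≢h k≢Ch x with v ≟ inc x
      ... | no v≢x = cong₂ _xor_ (far h∼v) (far k∼v)
        where
        far : ∀ {h} → inc h ≡ v → ends C h x ≡ false
        far h∼v = ends-other C
          (λ h≡x → v≢x (trans (sym h∼v) (cong inc h≡x)))
          (λ h≡Cx → v≢x (trans (sym h∼v) (trans (cong inc h≡Cx) (partner-inc C x))))
      ... | yes v≡x with four-halfEdges (trans k∼v (sym h∼v)) (sym (trans h∼v v≡x)) k≢h k≢Ch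
      ...   | here refl = cong₂ _xor_ (ends-self C h) (ends-other C k≢h k≢Ch)
      ...   | there (here refl) = cong₂ _xor_ (ends-partner C h)
        (ends-other C k≢Ch (λ e → k≢h (trans e (partner-involutive C h))))
      ...   | there (there (here refl)) = cong₂ _xor_
        (ends-other C (≢-sym k≢h) (λ h≡Ck → k≢Ch (partner-flip C (sym h≡Ck))))
        (ends-self C k)
      ...   | there (there (there (here refl))) = cong₂ _xor_
        (ends-other C (λ h≡Ck → k≢Ch (partner-flip C (sym h≡Ck)))
                    (λ e → k≢h (sym (trans e (partner-involutive C k)))))
        (ends-partner C k)

      -- An arc of a circuit between two visits of v jumps along C only at v.
      arc-hasJumps : ∀ {v} (c : Circuit C) {i k} → i < k → k < len c →
                     inc (walk C (start c) i) ≡ v → inc (walk C (start c) k) ≡ v →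
                     HasJumps C (𝟙 v) (arc C (walk C (start c) i) (k ∸ i))
      arc-hasJumps {v} c {i} {k} i<k k< i∼v k∼v = record
        { opp-invariant = arc-opp-invariant C (k ∸ i) _
        ; jump = λ x → begin
            arc C h (k ∸ i) x xor arc C h (k ∸ i) (partner C x) ≡⟨ arc-jump C (k ∸ i) h x ⟩
            ends C h x xor ends C (walk C h (k ∸ i)) x
              ≡⟨ cong (λ k → ends C h x xor ends C k x) (walk-∸ C (start c) (ℕ.<⇒≤ i<k)) ⟩
            ends C h x xor ends C (walk C (start c) k) x
              ≡⟨ ends-at-vertex i∼v k∼v
                   (λ e → ℕ.<⇒≢ i<k (sym (walk-positions c k< (ℕ.<-trans i<k k<) e)))
                   (walk-≢-partner-walk C (start c) k i) x ⟩
            𝟙 v (inc x) ∎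
        }
        where
        open ≡-Reasoning
        h = walk C (start c) i

-- The relative interlacement matrix

    module _ {C P : CircuitPartition F} (apart : ∀ v → ¬ SameTransition P C v) where

      -- Two transitions at a vertex that have one pair in common also agree on
      -- the remaining two half-edges.
      partners-differ : ∀ x → partner P x ≢ partner C x
      partners-differ x Px≡Cx = apart (inc x) same
        where
        same : ∀ z → inc z ≡ inc x → partner P z ≡ partner C z
        same z z∼x with z ≟ x | z ≟ partner C x
        ... | yes refl | _        = Px≡Cx
        ... | no _     | yes refl = trans (cong (partner P) (sym Px≡Cx))
          (trans (partner-involutive P x) (sym (partner-involutive C x)))
        ... | no z≢x   | no z≢Cx with four-halfEdges C {x} {z} {partner P z} z∼x
                                       (trans (partner-inc P z) z∼x) z≢x z≢Cx
        ...   | here Pz≡x = contradiction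
          (trans (partner-flip P Pz≡x) Px≡Cx) z≢Cx
        ...   | there (here Pz≡Cx) = contradiction (partner-injective P (trans Pz≡Cx (sym Px≡Cx))) z≢x
        ...   | there (there (here Pz≡z)) = contradiction Pz≡z (partner-fixfree P z)
        ...   | there (there (there (here Pz≡Cz))) = Pz≡Cz

      halfEdges-around : ∀ {x z} → inc z ≡ inc x →
                         z ∈ x ∷ partner C x ∷ partner P x ∷ partner C (partner P x) ∷ []
      halfEdges-around {x} z∼x =
        four-halfEdges C (partner-inc P x) z∼x (partner-fixfree P x) (partners-differ x)

      partners-commute : ∀ x → partner P (partner C x) ≡ partner C (partner P x)
      partners-commute x with halfEdges-around {x} {partner P (partner C x)}
                                (trans (partner-inc P (partner C x)) (partner-inc C x))
      ... | here e = contradiction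
        (sym (partner-flip P e)) (partners-differ x)
      ... | there (here e) = contradiction e (partner-fixfree P _)
      ... | there (there (here e)) = contradiction (partner-injective P e) (partner-fixfree C x)
      ... | there (there (there (here e))) = e

      ℐ-diagonal : ∀ v → (ℐ[ P ] C) v v ≡ does (hasLabel? C P v ψ)
      ℐ-diagonal v = entry (dec-true (v ≟ v) refl) (dec-false (sameTransition? P C v) (apart v))
        where
        entry : ∀ {b p q r : Bool} → b ≡ true → p ≡ false → (if b then p ∨ q else r) ≡ q
        entry refl refl = refl

      ℐ-offDiagonal : ∀ {v w} → v ≢ w → (ℐ[ P ] C) v w ≡ does (interlaced? C v w)
      ℐ-offDiagonal {v} {w} v≢w =
        entry (dec-false (v ≟ w) v≢w) (dec-false (sameTransition? P C v) (apart v))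
              (dec-false (sameTransition? P C w) (apart w))
        where
        entry : ∀ {b p q r s : Bool} → b ≡ false → p ≡ false → q ≡ false →
                (if b then s else if p ∨ q then false else r) ≡ r
        entry refl refl refl = refl

      module _ (euler : IsEulerSystem C) where

        -- The circuit from x visits the vertex of x again, along one of the two
        -- half-edges that are neither x nor partner C x.
        second-visit : ∀ x → ∃[ m ] 0 < m × m < len (circuitFrom C x) ×
          (walk C x m ≡ partner P x ⊎ walk C x m ≡ partner C (partner P x))
        second-visit x with passes-each-pair euler (circuitFrom C x) (zero , refl) (sym (partner-inc P x))
        ... | inj₁ (zero  , e) = contradiction (sym e) (partner-fixfree P x)
        ... | inj₁ (suc i , e) = _ , s≤s z≤n , toℕ<n (suc i) , inj₁ e
        ... | inj₂ (zero  , e) = contradiction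
          (partner-flip C (sym e)) (partners-differ x)
        ... | inj₂ (suc i , e) = _ , s≤s z≤n , toℕ<n (suc i) , inj₂ e

        second-visit-inc : ∀ {x k} → k ≡ partner P x ⊎ k ≡ partner C (partner P x) → inc k ≡ inc x
        second-visit-inc (inj₁ refl) = partner-inc P _
        second-visit-inc (inj₂ refl) = trans (partner-inc C _) (partner-inc P _)

        -- The circuit from x leaves its vertex along x and partner P x, hence the
        -- transition of P pairs the out-directed half-edges.
        ψ-label : ∀ {x m} → walk C x m ≡ partner P x → HasLabel C P (inc x) ψ
        ψ-label {x} {m} k≡Px = c , (zero , refl) , λ h h∼x → ins h∼x , outs h∼x
          where
          c = circuitFrom C x
          out-x : OutDirected c x
          out-x = zero , refl
          out-Px : OutDirected c (partner P x)
          out-Px = subst (OutDirected c) k≡Px (out-walk c m out-x)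
          outs : ∀ {h} → inc h ≡ inc x → OutDirected c h → OutDirected c (partner P h)
          outs h∼x o with halfEdges-around h∼x
          ... | here refl = out-Px
          ... | there (here refl) = contradiction o (out⇒partner-not-out c out-x)
          ... | there (there (here refl)) = subst (OutDirected c) (sym (partner-involutive P x)) out-x
          ... | there (there (there (here refl))) = contradiction o (out⇒partner-not-out c out-Px)
          ins : ∀ {h} → inc h ≡ inc x → InDirected c h → InDirected c (partner P h)
          ins {h} h∼x i = partner-out⇒in c (subst (OutDirected c) (partners-commute h)
            (outs (trans (partner-inc C h) h∼x) (in⇒partner-out c i)))

        -- The given circuit c traverses that of x in either direction.  If c leaves
        -- along x, then it also leaves along partner C (partner P x) because the
        -- walk from x does, and along partner P x by the label ψ.  If c leaves
        -- along partner C x, then by the label ψ it also leaves along partner C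
        -- (partner P x), from where the walk returns to x.
        ¬ψ-label : ∀ {x m} → m < len (circuitFrom C x) →
                   walk C x m ≡ partner C (partner P x) → ¬ HasLabel C P (inc x) ψ
        ¬ψ-label {x} {m} m<len k≡CPx (c , (i , i∼x) , labelled)
          with passes-each-pair euler c (i , refl) i∼x
        ... | inj₁ out-x = out⇒partner-not-out c (proj₂ (labelled x refl) out-x)
          (subst (OutDirected c) k≡CPx (out-walk c m out-x))
        ... | inj₂ out-Cx = out⇒partner-not-out c
          (subst (OutDirected c) back (out-walk c (len (circuitFrom C x) ∸ m) out-CPx)) out-Cx
          where
          out-CPx : OutDirected c (partner C (partner P x))
          out-CPx = subst (OutDirected c) (partners-commute x)
            (proj₂ (labelled (partner C x) (partner-inc C x)) out-Cx)
          back : walk C (partner C (partner P x)) (len (circuitFrom C x) ∸ m) ≡ x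
          back = trans (cong (λ k → walk C k (len (circuitFrom C x) ∸ m)) (sym k≡CPx))
            (trans (walk-∸ C x (ℕ.<⇒≤ m<len)) (IsCircuit.closed (proper (circuitFrom C x))))

        -- It suffices to consider the arc from x to the second visit of its vertex:
        -- it contains the edge of x but not the edge at position m.
        jump-diagonal : ∀ {x f} → HasJumps C (𝟙 (inc x)) f →
                        f x xor f (partner P x) ≡ does (hasLabel? C P (inc x) ψ)
        jump-diagonal {x} {f} J with second-visit x
        ... | m , 0<m , m<len , k = trans
          (jumps-determine euler J b-jumps (sym (partner-inc P x)))
          (trans (cong (_xor b (partner P x)) b-start) (label k))
          where
          c = circuitFrom C x
          b = arc C x m
          b-jumps : HasJumps C (𝟙 (inc x)) b
          b-jumps = arc-hasJumps C c 0<m m<len refl (second-visit-inc k)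
          b-start : b x ≡ true
          b-start = arc-inside C c m {0} {0} (ℕ.<⇒≤ m<len) z≤n 0<m
          b-end : b (walk C x m) ≡ false
          b-end = arc-outside C c m {0} {m} (ℕ.<⇒≤ m<len) m<len (inj₂ ℕ.≤-refl)
          label : walk C x m ≡ partner P x ⊎ walk C x m ≡ partner C (partner P x) →
                  true xor b (partner P x) ≡ does (hasLabel? C P (inc x) ψ)
          label (inj₁ k≡Px) = trans (cong (true xor_) (trans (cong b (sym k≡Px)) b-end))
            (sym (dec-true (hasLabel? C P (inc x) ψ) (ψ-label {x} {m} k≡Px)))
          label (inj₂ k≡CPx) = trans (cong (true xor_) b-Px)
            (sym (dec-false (hasLabel? C P (inc x) ψ) (¬ψ-label m<len k≡CPx)))
            where
            b-Px : b (partner P x) ≡ true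
            b-Px = begin
              b (partner P x)        ≡⟨ xor-identityʳ _ ⟨
              b (partner P x) xor false
                ≡⟨ cong (b (partner P x) xor_) (trans (cong b (sym k≡CPx)) b-end) ⟨
              b (partner P x) xor b (partner C (partner P x))  ≡⟨ jump b-jumps (partner P x) ⟩
              𝟙 (inc x) (inc (partner P x))                    ≡⟨ cong (𝟙 (inc x)) (partner-inc P x) ⟩
              𝟙 (inc x) (inc x)                                ≡⟨ 𝟙-refl (inc x) ⟩
              true                                             ∎
              where open ≡-Reasoning

        -- An arc of the circuit from h that contains the edge of y but not that of z,
        -- both at another vertex, passes through that vertex once; the circuit
        -- passes through it again after the end of the arc.
        jumping⇒interlaced : ∀ {h m y z} → 0 < m → m < len (circuitFrom C h) →
          inc (walk C h m) ≡ inc h → inc y ≢ inc h → inc z ≡ inc y →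
          arc C h m y ≡ true → arc C h m z ≡ false → Interlaced C (inc h) (inc y)
        jumping⇒interlaced {h} {m} {y} {z} 0<m m<len m∼h y≁h z∼y by bz =
          ≢-sym y≁h , c , zero , j , fromℕ< m<len , l ,
          (0<j , subst (toℕ j <_) (sym m≡) j<m , subst (_< toℕ l) (sym m≡) m<l) ,
          (refl , j∼y , trans (cong (inc ∘ walk C h) m≡) m∼h , trans l∼z z∼y)
          where
          c = circuitFrom C h
          b = arc C h m
          m≡ : toℕ (fromℕ< m<len) ≡ m
          m≡ = toℕ-fromℕ< m<len
          J : HasJumps C (𝟙 (inc h)) b
          J = arc-hasJumps C c 0<m m<len refl m∼h
          -- The arc has the same value at u as at some half-edge along which c
          -- leaves the vertex of u.
          position : ∀ {u} → inc u ≢ inc h → OutDirected c u ⊎ OutDirected c (partner C u) →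
                     ∃[ j ] vertex c j ≡ inc u × b (out c j) ≡ b u
          position u≁h (inj₁ (j , refl)) = j , refl , refl
          position {u} u≁h (inj₂ (j , e))  = j , trans (cong inc e) (partner-inc C u) ,
            trans (cong b e) (no-jump J (𝟙-≢ (≢-sym u≁h)))
          visits-y : OutDirected c y ⊎ OutDirected c (partner C y)
          visits-y = let n , same = arc-true⇒contains C m h y by
                     in contains⇒out c (out-walk c n (zero , refl)) same
          visits-z : OutDirected c z ⊎ OutDirected c (partner C z)
          visits-z with visits-y
          ... | inj₁ o = passes-each-pair euler c o (sym z∼y)
          ... | inj₂ o = passes-each-pair euler c o (trans (partner-inc C y) (sym z∼y))
          at-y = position y≁h visits-y
          at-z = position (y≁h ∘ trans (sym z∼y)) visits-z
          j = proj₁ at-y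
          l = proj₁ at-z
          j∼y = proj₁ (proj₂ at-y)
          l∼z = proj₁ (proj₂ at-z)
          0<j : 0 < toℕ j
          0<j = ℕ.n≢0⇒n>0 λ j≡0 → y≁h (trans (sym j∼y) (cong (inc ∘ walk C h) j≡0))
          j<m : toℕ j < m
          j<m = ℕ.≰⇒> λ m≤j → case trans (sym (trans (proj₂ (proj₂ at-y)) by))
            (arc-outside C c m {0} (ℕ.<⇒≤ m<len) (toℕ<n j) (inj₂ m≤j)) of λ ()
          m≤l : m ≤ toℕ l
          m≤l = ℕ.≮⇒≥ λ l<m → case trans (sym (trans (proj₂ (proj₂ at-z)) bz))
            (arc-inside C c m {0} (ℕ.<⇒≤ m<len) z≤n l<m) of λ ()
          m<l : m < toℕ l
          m<l = ℕ.≤∧≢⇒< m≤l λ m≡l → y≁h (trans (sym (trans l∼z z∼y))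
            (trans (cong (inc ∘ walk C h) (sym m≡l)) m∼h))

        -- Take the arc of c between the two visits of v: it contains the edge at
        -- position j but not the edge at position l.
        jump-interlaced : ∀ {v x f} → HasJumps C (𝟙 v) f → Interlaced C v (inc x) →
                          f x xor f (partner P x) ≡ true
        jump-interlaced {v} {x} {f} J
          (v≢x , c , i , j , k , l , (i<j , j<k , k<l) , (i∼v , j∼x , k∼v , l∼x)) =
          trans (jumps-determine euler J b-jumps (sym (partner-inc P x)))
                (differ (values j∼x) (values l∼x))
          where
          b = arc C (out c i) (toℕ k ∸ toℕ i)
          i<k = ℕ.<-trans i<j j<k
          i+[k∸i]≡k : toℕ i + (toℕ k ∸ toℕ i) ≡ toℕ k
          i+[k∸i]≡k = ℕ.m+[n∸m]≡n (ℕ.<⇒≤ i<k)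
          k≤len : toℕ i + (toℕ k ∸ toℕ i) ≤ len c
          k≤len = subst (_≤ len c) (sym i+[k∸i]≡k) (ℕ.<⇒≤ (toℕ<n k))
          b-jumps : HasJumps C (𝟙 v) b
          b-jumps = arc-hasJumps C c i<k (toℕ<n k) i∼v k∼v
          b-j : b (out c j) ≡ true
          b-j = arc-inside C c (toℕ k ∸ toℕ i) k≤len (ℕ.<⇒≤ i<j) (subst (toℕ j <_) (sym i+[k∸i]≡k) j<k)
          b-l : b (out c l) ≡ false
          b-l = arc-outside C c (toℕ k ∸ toℕ i) k≤len (toℕ<n l)
            (inj₂ (subst (_≤ toℕ l) (sym i+[k∸i]≡k) (ℕ.<⇒≤ k<l)))
          -- b takes at most two values at inc x, one on each pair of C.
          values : ∀ {z} → inc z ≡ inc x → b z ≡ b x ⊎ b z ≡ b (partner P x)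
          values z∼x with halfEdges-around z∼x
          ... | here refl = inj₁ refl
          ... | there (here refl) = inj₁ (no-jump b-jumps (𝟙-≢ v≢x))
          ... | there (there (here refl)) = inj₂ refl
          ... | there (there (there (here refl))) = inj₂
            (no-jump b-jumps (𝟙-≢ (v≢x ∘ λ e → trans e (partner-inc P x))))
          differ : b (out c j) ≡ b x ⊎ b (out c j) ≡ b (partner P x) →
                   b (out c l) ≡ b x ⊎ b (out c l) ≡ b (partner P x) →
                   b x xor b (partner P x) ≡ true
          differ (inj₁ p) (inj₁ q) = case trans (sym b-j) (trans p (trans (sym q) b-l)) of λ ()
          differ (inj₁ p) (inj₂ q) = cong₂ _xor_ (trans (sym p) b-j) (trans (sym q) b-l)
          differ (inj₂ p) (inj₁ q) = cong₂ _xor_ (trans (sym q) b-l) (trans (sym p) b-j)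
          differ (inj₂ p) (inj₂ q) = case trans (sym b-j) (trans p (trans (sym q) b-l)) of λ ()

        -- An edge function whose only jump along C is at v.
        arc-at : ∀ v → ∃[ b ] HasJumps C (𝟙 v) b
        arc-at v with halfEdge-at v
        ... | h , refl with second-visit h
        ...   | m , 0<m , m<len , k =
          _ , arc-hasJumps C (circuitFrom C h) 0<m m<len refl (second-visit-inc k)

        jump-not-interlaced : ∀ {v x f} → HasJumps C (𝟙 v) f → v ≢ inc x →
                              ¬ Interlaced C v (inc x) → f x xor f (partner P x) ≡ false
        jump-not-interlaced {v} {x} {f} J v≢x ¬int with halfEdge-at v
        ... | h , refl with second-visit h
        ...   | m , 0<m , m<len , k = trans
          (jumps-determine euler J (arc-hasJumps C (circuitFrom C h) 0<m m<len refl m∼h)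
            (sym (partner-inc P x)))
          (constant (b x) (b (partner P x)) refl refl)
          where
          b = arc C h m
          m∼h = second-visit-inc k
          constant : ∀ p q → b x ≡ p → b (partner P x) ≡ q → p xor q ≡ false
          constant true  true  _ _ = refl
          constant false false _ _ = refl
          constant true  false p q = contradiction
            (jumping⇒interlaced 0<m m<len m∼h (≢-sym v≢x) (partner-inc P x) p q) ¬int
          constant false true  p q = contradiction
            (subst (Interlaced C (inc h)) (partner-inc P x)
              (jumping⇒interlaced 0<m m<len m∼h (≢-sym (v≢x ∘ λ e → trans e (partner-inc P x)))
                (sym (partner-inc P x)) q p)) ¬int

        -- The jumps along P form the row v of the relative interlacement matrix.
        jump-entry : ∀ {v f} → HasJumps C (𝟙 v) f → ∀ x →
                     f x xor f (partner P x) ≡ (ℐ[ P ] C) v (inc x)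
        jump-entry {v} {f} J x = entry (v ≟ inc x)
          where
          offDiagonal : v ≢ inc x → Dec (Interlaced C v (inc x)) →
                        f x xor f (partner P x) ≡ does (interlaced? C v (inc x))
          offDiagonal v≢x (yes i) = trans (jump-interlaced {v} {x} {f} J i) (sym (dec-true (interlaced? C v (inc x)) i))
          offDiagonal v≢x (no ¬i) =
            trans (jump-not-interlaced {v} {x} {f} J v≢x ¬i) (sym (dec-false (interlaced? C v (inc x)) ¬i))
          entry : Dec (v ≡ inc x) → f x xor f (partner P x) ≡ (ℐ[ P ] C) v (inc x)
          entry (yes refl) = trans (jump-diagonal {x} {f} J) (sym (ℐ-diagonal (inc x)))
          entry (no v≢x)   = trans (offDiagonal v≢x (interlaced? C v (inc x))) (sym (ℐ-offDiagonal v≢x))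

        -- The jumps along C and those along P are related by the relative
        -- interlacement matrix, acting on row vectors from the right.
        jumps-transfer : ∀ {a f} → HasJumps C a f →
                         HasJumps P (λ w → sum λ v → a v ∧ (ℐ[ P ] C) v w) f
        jumps-transfer {a} {f} J = record { opp-invariant = opp-invariant J ; jump = λ x → begin
          f x xor f (partner P x)
            ≡⟨ jumps-determine euler J S-jumps (sym (partner-inc P x)) ⟩
          S x xor S (partner P x)
            ≡⟨ S-jump (partner P x) ⟩
          sum (λ v → a v ∧ (b v x xor b v (partner P x)))
            ≡⟨ sum-cong-≗ (λ v → cong (a v ∧_) (jump-entry {v} {b v} (b-jumps v) x)) ⟩
          sum (λ v → a v ∧ (ℐ[ P ] C) v (inc x)) ∎ }
          where
          open ≡-Reasoning
          b : Vertex → HalfEdge → Bool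
          b v = proj₁ (arc-at v)
          b-jumps : ∀ v → HasJumps C (𝟙 v) (b v)
          b-jumps v = proj₂ (arc-at v)
          -- S combines the functions b v so as to have the same jumps along C as f.
          S : HalfEdge → Bool
          S x = sum λ v → a v ∧ b v x
          S-jump : ∀ {x} y → S x xor S y ≡ sum (λ v → a v ∧ (b v x xor b v y))
          S-jump {x} y = trans (sym (∑-distrib-+ (λ v → a v ∧ b v x) (λ v → a v ∧ b v y)))
            (sum-cong-≗ (λ v → sym (∧-distribˡ-xor (a v) (b v x) (b v y))))
          S-jumps : HasJumps C a S
          S-jumps = record
            { opp-invariant = λ x → sum-cong-≗ (λ v → cong (a v ∧_) (opp-invariant (b-jumps v) x))
            ; jump = λ x → begin
                S x xor S (partner C x)  ≡⟨ S-jump (partner C x) ⟩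
                sum (λ v → a v ∧ (b v x xor b v (partner C x)))
                  ≡⟨ sum-cong-≗ (λ v → cong (a v ∧_) (jump (b-jumps v) x)) ⟩
                sum (λ v → a v ∧ 𝟙 v (inc x))  ≡⟨ sum-∧-𝟙 a (inc x) ⟩
                a (inc x)                      ∎
            }

corollary21 : (F : Multigraph) → FourRegular F →
    (C C′ C″ : CircuitPartition F) →
    IsEulerSystem C → IsEulerSystem C′ → IsEulerSystem C″ →
    Compatible C C′ → Compatible C C″ → Compatible C′ C″ →
    ∀ v w → ((ℐ[ C ] C′) · (ℐ[ C″ ] C) · (ℐ[ C′ ] C″)) v w ≡ 𝟙 v w
corollary21 F regular C C′ C″ euler euler′ euler″ C#C′ C#C″ C′#C″ v w
  with halfEdge-at {F} regular w
... | x , refl = trans (sym (HasJumps.jump around x)) (HasJumps.jump J′ x)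
  where
  -- b is carried around the cycle C′, C, C″, C′.
  b = proj₁ (arc-at {F} regular {C′} {C} C#C′ euler′ v)
  J′ : HasJumps C′ (𝟙 v) b
  J′ = proj₂ (arc-at {F} regular {C′} {C} C#C′ euler′ v)
  J : HasJumps C ((ℐ[ C ] C′) v) b
  J = record
    { opp-invariant = HasJumps.opp-invariant J′
    ; jump          = jump-entry {F} regular {C′} {C} C#C′ euler′ {v} {b} J′
    }
  J″ : HasJumps C″ (((ℐ[ C ] C′) · (ℐ[ C″ ] C)) v) b
  J″ =
    jumps-transfer {F} regular {C} {C″} (λ v same → C#C″ v λ h at → sym (same h at)) euler
      {(ℐ[ C ] C′) v} {b} J
  around : HasJumps C′ (((ℐ[ C ] C′) · (ℐ[ C″ ] C) · (ℐ[ C′ ] C″)) v) b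
  around = jumps-transfer {F} regular {C″} {C′} C′#C″ euler″
    {((ℐ[ C ] C′) · (ℐ[ C″ ] C)) v} {b} J″
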